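{- Let $u, v \in A^*$. Then $u \equiv_{\mathrm{B}} v$ if and only if $u \equiv_{\mathrm{S}} v$ and $u \equiv_{\mathrm{S}^\#} v$.
   Context: $A = \{a_1 < a_2 < \cdots\}$ is a totally ordered infinite alphabet and $A^*$ is the free monoid of words on $A$. A congruence on $A^*$ is an equivalence relation compatible with concatenation. The Baxter congruence $\equiv_{\mathrm{B}}$ is the smallest congruence on $A^*$ such that, for all words $u, v \in A^*$ and letters $a,b,c,d \in A$: $\; c\,u\,a d\,v\,b \equiv_{\mathrm{B}} c\,u\,d a\,v\,b$ whenever $a \leq b < c \leq d$, and $\; b\,u\,d a\,v\,c \equiv_{\mathrm{B}} b\,u\,a d\,v\,c$ whenever $a < b \leq c < d$. The sylvester congruence $\equiv_{\mathrm{S}}$ is the smallest congruence on $A^*$ such that $a c\,u\,b \equiv_{\mathrm{S}} c a\,u\,b$ for all $u \in A^*$ and letters $a \leq b < c$. The $\#$-sylvester congruence $\equiv_{\mathrm{S}^\#}$ is the smallest congruence on $A^*$ such that $b\,u\,a c \equiv_{\mathrm{S}^\#} b\,u\,c a$ for all $u \in A^*$ and letters $a < b \leq c$. -}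

module Defs where

open import Algebra.Structures using (IsMagma)
open import Data.List.Base using (List; []; _∷_; _++_)
open import Data.Nat.Base using (ℕ; _≤_; _<_)
open import Level using (0ℓ)
open import Relation.Binary.Core using (Rel; _⇒_)

-- The alphabet {a₁ < a₂ < ⋯} is ℕ with its usual order; the letter aᵢ₊₁ is i.
Letter : Set
Letter = ℕ

Word : Set
Word = List Letter

-- `IsMagma _≈_ _++_` says exactly that _≈_ is an equivalence relation
-- compatible with concatenation on both sides.
IsCongruence : Rel Word 0ℓ → Set
IsCongruence _≈_ = IsMagma _≈_ _++_

data Congruence (R : Rel Word 0ℓ) : Rel Word 0ℓ where
  gen    : ∀ {u v} → R u v → Congruence R u v
  crefl  : ∀ {u} → Congruence R u u
  csym   : ∀ {u v} → Congruence R u v → Congruence R v u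
  ctrans : ∀ {u v w} → Congruence R u v → Congruence R v w → Congruence R u w
  ccong  : ∀ {u u′ v v′} → Congruence R u u′ → Congruence R v v′ →
           Congruence R (u ++ v) (u′ ++ v′)

-- `Congruence R` is the smallest congruence containing R: it contains R by
-- `gen`, and the next two facts give the rest.
Congruence-isCongruence : (R : Rel Word 0ℓ) → IsCongruence (Congruence R)
Congruence-isCongruence R = record
  { isEquivalence = record { refl = crefl ; sym = csym ; trans = ctrans }
  ; ∙-cong        = ccong
  }

Congruence-least : (R _≈_ : Rel Word 0ℓ) → IsCongruence _≈_ → R ⇒ _≈_ →
                   Congruence R ⇒ _≈_
Congruence-least R _≈_ isCong R⇒≈ = go
  where
  open IsMagma isCong
  go : Congruence R ⇒ _≈_
  go (gen r)      = R⇒≈ r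
  go crefl        = refl
  go (csym p)     = sym (go p)
  go (ctrans p q) = trans (go p) (go q)
  go (ccong p q)  = ∙-cong (go p) (go q)

data BaxterRel : Rel Word 0ℓ where
  baxter₁ : (u v : Word) (a b c d : Letter) → a ≤ b → b < c → c ≤ d →
            BaxterRel (c ∷ u ++ a ∷ d ∷ v ++ b ∷ [])
                      (c ∷ u ++ d ∷ a ∷ v ++ b ∷ [])
  baxter₂ : (u v : Word) (a b c d : Letter) → a < b → b ≤ c → c < d →
            BaxterRel (b ∷ u ++ d ∷ a ∷ v ++ c ∷ [])
                      (b ∷ u ++ a ∷ d ∷ v ++ c ∷ [])

data SylvesterRel : Rel Word 0ℓ where
  sylvester : (u : Word) (a b c : Letter) → a ≤ b → b < c →
              SylvesterRel (a ∷ c ∷ u ++ b ∷ []) (c ∷ a ∷ u ++ b ∷ [])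

data SylvesterRel# : Rel Word 0ℓ where
  sylvester# : (u : Word) (a b c : Letter) → a < b → b ≤ c →
               SylvesterRel# (b ∷ u ++ a ∷ c ∷ []) (b ∷ u ++ c ∷ a ∷ [])

infix 4 _≡B_ _≡S_ _≡S#_

_≡B_ : Rel Word 0ℓ
_≡B_ = Congruence BaxterRel

_≡S_ : Rel Word 0ℓ
_≡S_ = Congruence SylvesterRel

_≡S#_ : Rel Word 0ℓ
_≡S#_ = Congruence SylvesterRel#

{-# OPTIONS --safe #-}
module Submission where

-- An adjacent swap is a Baxter move exactly when it is at once a sylvester
-- move (a letter to its right lies between the two) and a #-sylvester move (a
-- letter to its left does).  The #-sylvester congruence preserves the number of
-- a's before the first letter of (a , c], and the sylvester congruence the
-- number of c's after the last letter of [a , c).  Let u and v be congruent for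
-- both, with a common prefix r, and let x be the letter of v after r.  The
-- invariants show that, while the first x of u beyond r travels left to join r,
-- each letter it meets is separated from x on both sides, so that every swap is
-- a Baxter move.

open import Defs
open import Data.List.Base using ([]; _∷_; _++_; _∷ʳ_; [_]; length; filter; reverse; takeWhile)
open import Data.List.Membership.Propositional using (_∈_; _∉_; find; lose)
open import Data.List.Membership.Propositional.Properties
  using (∈-∃++; ∈-++⁺ˡ; ∈-++⁺ʳ; ∈-++⁻; ∈-filter⁺; ∈-length)
open import Data.List.Properties
  using (++-assoc; ∷ʳ-++; filter-++; filter-accept; filter-reject;
         length-++; reverse-++; unfold-reverse)
open import Data.List.Relation.Binary.Permutation.Propositional
  using (_↭_; ↭-refl; ↭-sym; ↭-trans; swap)
open import Data.List.Relation.Binary.Permutation.Propositional.Properties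
  using (++⁺; ++⁺ˡ; drop-∷; drop-mid; filter-↭; ↭-length; ↭-reverse; Any-resp-↭;
         ∈-resp-↭; ↭-empty-inv)
open import Data.List.Relation.Unary.Any using (Any; here; there; any?)
import Data.List.Relation.Unary.Any.Properties as Any
open import Data.List.Reverse using (Reverse; reverseView; []; _∶_∶ʳ_)
open import Data.Nat.Base using (ℕ; suc; _+_; _≤_; _<_; z≤n)
open import Data.Nat.Induction using (<-wellFounded)
open import Data.Nat.Properties
open import Data.Product.Base using (_×_; _,_; proj₁; proj₂; ∃₂)
open import Data.Sum.Base using (inj₁; inj₂; [_,_]′)
open import Function.Base using (_∘_)
open import Function.Bundles using (_⇔_; mk⇔)
open import Induction.WellFounded using (Acc; acc)
open import Level using (0ℓ)
open import Relation.Binary.Core using (Rel; _⇒_)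
open import Relation.Binary.Definitions using (tri<; tri≈; tri>)
open import Relation.Binary.PropositionalEquality
  using (_≡_; _≢_; refl; sym; trans; cong; cong₂; subst; subst₂; module ≡-Reasoning)
open import Relation.Nullary using (¬_; yes; no; contradiction)
open import Relation.Nullary.Decidable using (_×-dec_; decidable-stable)
open import Relation.Unary using (Pred; Decidable)
open import Relation.Unary.Properties using (∁?)

-- Occurrences of a letter in a word

count : Letter → Word → ℕ
count l w = length (filter (l ≟_) w)

count-++ : ∀ l u v → count l (u ++ v) ≡ count l u + count l v
count-++ l u v = trans (cong length (filter-++ (l ≟_) u v)) (length-++ (filter (l ≟_) u))

count-↭ : ∀ l {u v} → u ↭ v → count l u ≡ count l v
count-↭ l p = ↭-length (filter-↭ (l ≟_) p)

count-reverse : ∀ l w → count l (reverse w) ≡ count l w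
count-reverse l w = count-↭ l (↭-reverse w)

count-head : ∀ l w → count l (l ∷ w) ≡ suc (count l w)
count-head l w = cong length (filter-accept (l ≟_) refl)

count-skip : ∀ {l x} w → l ≢ x → count l (x ∷ w) ≡ count l w
count-skip {l} w l≢x = cong length (filter-reject (l ≟_) l≢x)

count-∉ : ∀ {l} w → l ∉ w → count l w ≡ 0
count-∉ []      _   = refl
count-∉ (x ∷ w) l∉w = trans (count-skip w (l∉w ∘ here)) (count-∉ w (l∉w ∘ there))

count-∈ : ∀ {l w} → l ∈ w → 0 < count l w
count-∈ {l} l∈w = ∈-length (∈-filter⁺ (l ≟_) l∈w refl)

-- Occurrences before the first letter of a set, and the induced congruences

module _ {Q : Pred Letter 0ℓ} (Q? : Decidable Q) (l : Letter) where

  -- If no letter of `w` lies in `Q`, every `l` in `w` is counted. With this default the count is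
  -- additive over a prefix that avoids `Q`.
  countBefore : Word → ℕ
  countBefore w = count l (takeWhile (∁? Q?) w)

  countBefore-accept : ∀ {x} w → Q x → countBefore (x ∷ w) ≡ 0
  countBefore-accept {x} w qx with Q? x
  ... | yes _  = refl
  ... | no ¬qx = contradiction qx ¬qx

  countBefore-reject : ∀ {x} w → ¬ Q x → countBefore (x ∷ w) ≡ count l [ x ] + countBefore w
  countBefore-reject {x} w ¬qx with Q? x
  ... | yes qx = contradiction qx ¬qx
  ... | no _   = count-++ l [ x ] _

  countBefore-++-any : ∀ {u} v → Any Q u → countBefore (u ++ v) ≡ countBefore u
  countBefore-++-any {x ∷ u} v q with Q? x | q
  ... | yes _  | _        = refl
  ... | no ¬qx | here qx  = contradiction qx ¬qx
  ... | no _   | there q′ =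
    trans (count-++ l [ x ] _)
      (trans (cong (count l [ x ] +_) (countBefore-++-any v q′)) (sym (count-++ l [ x ] _)))

  countBefore-++-none : ∀ u v → ¬ Any Q u → countBefore (u ++ v) ≡ count l u + countBefore v
  countBefore-++-none []      v ¬q = refl
  countBefore-++-none (x ∷ u) v ¬q = begin
    countBefore (x ∷ u ++ v)
      ≡⟨ countBefore-reject (u ++ v) (¬q ∘ here) ⟩
    count l [ x ] + countBefore (u ++ v)
      ≡⟨ cong (count l [ x ] +_) (countBefore-++-none u v (¬q ∘ there)) ⟩
    count l [ x ] + (count l u + countBefore v)
      ≡⟨ +-assoc (count l [ x ]) _ _ ⟨
    count l [ x ] + count l u + countBefore v
      ≡⟨ cong (_+ countBefore v) (count-++ l [ x ] u) ⟨
    count l (x ∷ u) + countBefore v ∎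
    where open ≡-Reasoning

  countBefore-hit : ∀ {u x} v → ¬ Any Q u → Q x → countBefore (u ++ x ∷ v) ≡ count l u
  countBefore-hit {u} {x} v ¬q qx = begin
    countBefore (u ++ x ∷ v)          ≡⟨ countBefore-++-none u (x ∷ v) ¬q ⟩
    count l u + countBefore (x ∷ v)   ≡⟨ cong (count l u +_) (countBefore-accept v qx) ⟩
    count l u + 0                     ≡⟨ +-identityʳ _ ⟩
    count l u                         ∎
    where open ≡-Reasoning

  countBefore≤count : ∀ w → countBefore w ≤ count l w
  countBefore≤count []      = z≤n
  countBefore≤count (x ∷ w) with Q? x
  ... | yes _ = z≤n
  ... | no _  = subst₂ _≤_ (sym (count-++ l [ x ] _)) (sym (count-++ l [ x ] w))
                  (+-monoʳ-≤ (count l [ x ]) (countBefore≤count w))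

  -- Only an `l` crossing the first letter of `Q` can alter the count. The two hypotheses cover both
  -- directions of such a crossing: in each, `Q` has already been met in `s`, where the count stops.
  countBefore-swap : ∀ s x y t → (Q x → y ≡ l → Any Q s) → (Q y → x ≡ l → Any Q s) →
                     countBefore (s ++ x ∷ y ∷ t) ≡ countBefore (s ++ y ∷ x ∷ t)
  countBefore-swap s x y t hx hy with any? Q? s
  ... | yes q = trans (countBefore-++-any _ q) (sym (countBefore-++-any _ q))
  ... | no ¬q = trans (countBefore-++-none s _ ¬q)
                  (trans (cong (count l s +_) swapped) (sym (countBefore-++-none s _ ¬q)))
    where
    swapped : countBefore (x ∷ y ∷ t) ≡ countBefore (y ∷ x ∷ t)
    swapped with Q? x in eqx | Q? y in eqy
    ... | yes _  | yes _  = refl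
    ... | yes qx | no _  rewrite eqx = sym (count-skip [] (λ l≡y → ¬q (hx qx (sym l≡y))))
    ... | no _   | yes qy rewrite eqy = count-skip [] (λ l≡x → ¬q (hy qy (sym l≡x)))
    ... | no _   | no _  rewrite eqx | eqy = count-↭ l (swap x y ↭-refl)

  infix 4 _≈_ _≈ʳ_

  -- Equality of contents makes "u has a letter in Q" depend only on the class
  -- of u, which compatibility with concatenation requires.
  _≈_ : Rel Word 0ℓ
  u ≈ v = u ↭ v × countBefore u ≡ countBefore v

  ≈-cong : ∀ {u u′ v v′} → u ≈ u′ → v ≈ v′ → u ++ v ≈ u′ ++ v′
  ≈-cong {u} {u′} {v} {v′} (p , e) (p′ , e′) = ++⁺ p p′ , eq
    where
    eq : countBefore (u ++ v) ≡ countBefore (u′ ++ v′)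
    eq with any? Q? u
    ... | yes q = trans (countBefore-++-any v q)
                    (trans e (sym (countBefore-++-any v′ (Any-resp-↭ p q))))
    ... | no ¬q = trans (countBefore-++-none u v ¬q)
                    (trans (cong₂ _+_ (count-↭ l p) e′)
                      (sym (countBefore-++-none u′ v′ (¬q ∘ Any-resp-↭ (↭-sym p)))))

  ≈-isCongruence : IsCongruence _≈_
  ≈-isCongruence = record
    { isEquivalence = record
        { refl  = ↭-refl , refl
        ; sym   = λ (p , e) → ↭-sym p , sym e
        ; trans = λ (p , e) (p′ , e′) → ↭-trans p p′ , trans e e′
        }
    ; ∙-cong = ≈-cong
    }

  -- Reversal turns "after the last" into "before the first", so the sylvester invariant is the same
  -- construction. As reversal is an anti-automorphism, compatibility with concatenation holds with
  -- the factors exchanged.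
  _≈ʳ_ : Rel Word 0ℓ
  u ≈ʳ v = reverse u ≈ reverse v

  ≈ʳ-isCongruence : IsCongruence _≈ʳ_
  ≈ʳ-isCongruence = record
    { isEquivalence = record
        { refl  = ↭-refl , refl
        ; sym   = λ (p , e) → ↭-sym p , sym e
        ; trans = λ (p , e) (p′ , e′) → ↭-trans p p′ , trans e e′
        }
    ; ∙-cong = λ {u} {u′} {v} {v′} p p′ →
        subst₂ _≈_ (sym (reverse-++ u v)) (sym (reverse-++ u′ v′)) (≈-cong p′ p)
    }

Between Between# : Letter → Letter → Pred Letter 0ℓ
Between  a c b = a ≤ b × b < c
Between# a c b = a < b × b ≤ c

between? : ∀ a c → Decidable (Between a c)
between? a c b = a ≤? b ×-dec b <? c

between#? : ∀ a c → Decidable (Between# a c)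
between#? a c b = a <? b ×-dec b ≤? c

countAfter : Letter → Letter → Word → ℕ
countAfter a c w = countBefore (between? a c) c (reverse w)

-- A generator matters only if it moves an `a` across a letter of (a , c]. The larger swapped letter
-- cannot be that `a`, since the smaller one would then have to exceed it. If the smaller one is,
-- the witness `b` lies in (a , c] and precedes both.
≡S#⇒≈ : ∀ a c {u v} → u ≡S# v → _≈_ (between#? a c) a u v
≡S#⇒≈ a c = Congruence-least SylvesterRel# _ (≈-isCongruence (between#? a c) a) rel
  where
  rel : SylvesterRel# ⇒ _≈_ (between#? a c) a
  rel (sylvester# u a′ b c′ a′<b b≤c′) =
    ++⁺ˡ (b ∷ u) (swap a′ c′ ↭-refl) ,
    countBefore-swap (between#? a c) a (b ∷ u) a′ c′ []
      (λ { (a<a′ , _) refl → contradiction (<-≤-trans a′<b b≤c′) (<-asym a<a′) })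
      (λ { (_ , c′≤c) refl → here (a′<b , ≤-trans b≤c′ c′≤c) })

-- Read backwards, the witness `b` precedes the swapped pair, and the argument for `≡S#⇒≈` applies
-- with the order of letters inverted.
≡S⇒≈ʳ : ∀ a c {u v} → u ≡S v → _≈ʳ_ (between? a c) c u v
≡S⇒≈ʳ a c = Congruence-least SylvesterRel _ (≈ʳ-isCongruence (between? a c) c) rel
  where
  reverse-swap : ∀ x y u b → reverse (x ∷ y ∷ u ++ [ b ]) ≡ (b ∷ reverse u) ++ y ∷ x ∷ []
  reverse-swap x y u b =
    trans (reverse-++ (x ∷ y ∷ u) [ b ])
      (cong (b ∷_) (reverse-++ (x ∷ y ∷ []) u))

  rel : SylvesterRel ⇒ _≈ʳ_ (between? a c) c
  rel (sylvester u a′ b c′ a′≤b b<c′) =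
    subst₂ (_≈_ (between? a c) c) (sym (reverse-swap a′ c′ u b)) (sym (reverse-swap c′ a′ u b))
      ( ++⁺ˡ (b ∷ reverse u) (swap c′ a′ ↭-refl)
      , countBefore-swap (between? a c) c (b ∷ reverse u) c′ a′ []
          (λ { (_ , c′<c) refl → contradiction (≤-<-trans a′≤b b<c′) (<-asym c′<c) })
          (λ { (a≤a′ , _) refl → here (≤-trans a≤a′ a′≤b , b<c′) }))

≡S#⇒↭ : ∀ {u v} → u ≡S# v → u ↭ v
-- The bounds are arbitrary: every pair yields the same permutation statement.
≡S#⇒↭ = proj₁ ∘ ≡S#⇒≈ 0 0

≡S⇒countAfter : ∀ a c {u v} → u ≡S v → countAfter a c u ≡ countAfter a c v
≡S⇒countAfter a c = proj₂ ∘ ≡S⇒≈ʳ a c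

≡S⇒↭ : ∀ {u v} → u ≡S v → u ↭ v
≡S⇒↭ {u} {v} p =
  ↭-trans (↭-sym (↭-reverse u)) (↭-trans (proj₁ (≡S⇒≈ʳ 0 0 p)) (↭-reverse v))

reverse-++-∷ : ∀ (u : Word) x v → reverse (u ++ x ∷ v) ≡ reverse v ++ x ∷ reverse u
reverse-++-∷ u x v = begin
  reverse (u ++ x ∷ v)           ≡⟨ reverse-++ u (x ∷ v) ⟩
  reverse (x ∷ v) ++ reverse u   ≡⟨ cong (_++ reverse u) (unfold-reverse x v) ⟩
  reverse v ∷ʳ x ++ reverse u    ≡⟨ ∷ʳ-++ (reverse v) x (reverse u) ⟩
  reverse v ++ x ∷ reverse u     ∎
  where open ≡-Reasoning

countAfter-hit : ∀ {a b c} u v → ¬ Any (Between a c) v → Between a c b →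
                 countAfter a c (u ++ b ∷ v) ≡ count c v
countAfter-hit {a} {b} {c} u v ¬q qb = begin
  countAfter a c (u ++ b ∷ v)
    ≡⟨ cong (countBefore (between? a c) c) (reverse-++-∷ u b v) ⟩
  countBefore (between? a c) c (reverse v ++ b ∷ reverse u)
    ≡⟨ countBefore-hit (between? a c) c (reverse u) (¬q ∘ Any.reverse⁻) qb ⟩
  count c (reverse v)
    ≡⟨ count-reverse c v ⟩
  count c v ∎
  where open ≡-Reasoning

countAfter-≤ : ∀ {a c} u v → Any (Between a c) v → countAfter a c (u ++ v) ≤ count c v
countAfter-≤ {a} {c} u v q = begin
  countAfter a c (u ++ v)
    ≡⟨ cong (countBefore (between? a c) c) (reverse-++ u v) ⟩
  countBefore (between? a c) c (reverse v ++ reverse u)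
    ≡⟨ countBefore-++-any (between? a c) c (reverse u) (Any.reverse⁺ q) ⟩
  countBefore (between? a c) c (reverse v)
    ≤⟨ countBefore≤count (between? a c) c (reverse v) ⟩
  count c (reverse v)
    ≡⟨ count-reverse c v ⟩
  count c v ∎
  where open ≤-Reasoning

-- Separating letters on both sides of an adjacent pair

++-∷-shift : ∀ (r p : Word) y w → (r ++ p) ++ y ∷ w ≡ (r ++ p ∷ʳ y) ++ w
++-∷-shift r p y w = trans (sym (∷ʳ-++ (r ++ p) y w)) (cong (_++ w) (++-assoc r p [ y ]))

++-cancelˡ-↭ : ∀ (r : Word) {u v} → r ++ u ↭ r ++ v → u ↭ v
++-cancelˡ-↭ []      p = p
++-cancelˡ-↭ (_ ∷ r) p = ++-cancelˡ-↭ r (drop-∷ p)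

remove-↭ : ∀ (r : Word) {p x q v} → (r ++ p) ++ x ∷ q ↭ r ++ x ∷ v → p ++ q ↭ v
remove-↭ r {p} {x} {q} e =
  ++-cancelˡ-↭ r (subst (_↭ _) (++-assoc r p q) (drop-mid (r ++ p) r e))

module _ (r : Word) {x y : Letter} {p q v : Word} (x∉p : x ∉ p) where

  -- Otherwise `y` is the last letter of [y , x) on the left-hand side, with the displayed `x` and
  -- those of `q` after it. On the right-hand side `v` contains a `y`, so the count is at most that
  -- of `x` in `v`, which is that of `q` alone: one too few.
  separated-right-> : y < x → (r ++ p) ++ y ∷ x ∷ q ≡S r ++ x ∷ v → Any (Between y x) q
  separated-right-> y<x e = decidable-stable (any? (between? y x) q) λ ¬q →
    <-irrefl refl (begin-strict
      count x q                              <⟨ n<1+n _ ⟩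
      suc (count x q)                        ≡⟨ count-head x q ⟨
      count x (x ∷ q)                        ≡⟨ countAfter-hit (r ++ p) (x ∷ q) (none ¬q) (≤-refl , y<x) ⟨
      countAfter y x ((r ++ p) ++ y ∷ x ∷ q) ≡⟨ ≡S⇒countAfter y x e ⟩
      countAfter y x (r ++ x ∷ v)            ≡⟨ cong (countAfter y x) (∷ʳ-++ r x v) ⟨
      countAfter y x (r ∷ʳ x ++ v)           ≤⟨ countAfter-≤ (r ∷ʳ x) v (lose y∈v (≤-refl , y<x)) ⟩
      count x v                              ≡⟨ count-↭ x rest ⟨
      count x (p ++ y ∷ q)                   ≡⟨ count-++ x p (y ∷ q) ⟩
      count x p + count x (y ∷ q)            ≡⟨ cong₂ _+_ (count-∉ p x∉p) (count-skip q (>⇒≢ y<x)) ⟩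
      count x q                              ∎)
    where
    open ≤-Reasoning

    none : ¬ Any (Between y x) q → ¬ Any (Between y x) (x ∷ q)
    none ¬q (here (_ , x<x)) = <-irrefl refl x<x
    none ¬q (there q′)       = ¬q q′

    rest : p ++ y ∷ q ↭ v
    rest = subst (_↭ v) (∷ʳ-++ p y q)
             (remove-↭ r (subst (_↭ _) (++-∷-shift r p y (x ∷ q)) (≡S⇒↭ e)))

    y∈v : y ∈ v
    y∈v = ∈-resp-↭ rest (∈-++⁺ʳ p (here refl))

  -- Otherwise `y` is the first letter of (x , y] on the left-hand side, and only the `x`'s of `r`
  -- precede it, as `p` has none. On the right-hand side `r ∷ʳ x` avoids (x , y], so at least one
  -- more `x` is counted.
  separated-left-< : x < y → (r ++ p) ++ y ∷ x ∷ q ≡S# r ++ x ∷ v → Any (Between# x y) (r ++ p)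
  separated-left-< x<y e = decidable-stable (any? (between#? x y) (r ++ p)) λ ¬q →
    <-irrefl refl (begin-strict
      count x r                                        <⟨ n<1+n _ ⟩
      suc (count x r)                                  ≡⟨ +-comm 1 (count x r) ⟩
      count x r + 1                                    ≡⟨ cong (count x r +_) (count-head x []) ⟨
      count x r + count x [ x ]                        ≡⟨ count-++ x r [ x ] ⟨
      count x (r ∷ʳ x)                                 ≤⟨ m≤m+n _ _ ⟩
      count x (r ∷ʳ x) + cb v                          ≡⟨ countBefore-++-none (between#? x y) x (r ∷ʳ x) v (none ¬q) ⟨
      cb (r ∷ʳ x ++ v)                                 ≡⟨ cong cb (∷ʳ-++ r x v) ⟩
      cb (r ++ x ∷ v)                                  ≡⟨ proj₂ (≡S#⇒≈ x y e) ⟨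
      cb ((r ++ p) ++ y ∷ x ∷ q)                       ≡⟨ countBefore-hit (between#? x y) x (x ∷ q) ¬q (x<y , ≤-refl) ⟩
      count x (r ++ p)                                 ≡⟨ count-++ x r p ⟩
      count x r + count x p                            ≡⟨ cong (count x r +_) (count-∉ p x∉p) ⟩
      count x r + 0                                    ≡⟨ +-identityʳ _ ⟩
      count x r                                        ∎)
    where
    open ≤-Reasoning

    cb : Word → ℕ
    cb = countBefore (between#? x y) x

    none : ¬ Any (Between# x y) (r ++ p) → ¬ Any (Between# x y) (r ∷ʳ x)
    none ¬q q′ with Any.++⁻ r q′
    ... | inj₁ q″                 = ¬q (Any.++⁺ˡ q″)
    ... | inj₂ (here (x<x , _)) = <-irrefl refl x<x

-- Otherwise the displayed `x` is the first letter of (y , x] in both words. On the left the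
-- displayed `y` and those of `r ++ p` precede it; on the right only those of `r` do.
separated-left-> : ∀ r {x y p q v} → y < x → (r ++ p) ++ y ∷ x ∷ q ≡S# r ++ x ∷ v →
                   Any (Between# y x) (r ++ p)
separated-left-> r {x} {y} {p} {q} {v} y<x e = decidable-stable (any? (between#? y x) (r ++ p)) λ ¬q →
  <-irrefl refl (begin-strict
    count y r                         ≤⟨ m≤m+n _ _ ⟩
    count y r + count y p             ≡⟨ count-++ y r p ⟨
    count y (r ++ p)                  <⟨ n<1+n _ ⟩
    suc (count y (r ++ p))            ≡⟨ +-comm 1 _ ⟩
    count y (r ++ p) + 1              ≡⟨ cong (count y (r ++ p) +_) (count-head y []) ⟨
    count y (r ++ p) + count y [ y ]  ≡⟨ count-++ y (r ++ p) [ y ] ⟨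
    count y ((r ++ p) ∷ʳ y)           ≡⟨ countBefore-hit (between#? y x) y q (none ¬q) (y<x , ≤-refl) ⟨
    cb ((r ++ p) ∷ʳ y ++ x ∷ q)       ≡⟨ cong cb (∷ʳ-++ (r ++ p) y (x ∷ q)) ⟩
    cb ((r ++ p) ++ y ∷ x ∷ q)        ≡⟨ proj₂ (≡S#⇒≈ y x e) ⟩
    cb (r ++ x ∷ v)                   ≡⟨ countBefore-hit (between#? y x) y {u = r} v (¬q ∘ Any.++⁺ˡ) (y<x , ≤-refl) ⟩
    count y r                         ∎)
  where
  open ≤-Reasoning

  cb : Word → ℕ
  cb = countBefore (between#? y x) y

  none : ¬ Any (Between# y x) (r ++ p) → ¬ Any (Between# y x) ((r ++ p) ∷ʳ y)
  none ¬q q′ with Any.++⁻ (r ++ p) q′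
  ... | inj₁ q″                 = ¬q q″
  ... | inj₂ (here (y<y , _)) = <-irrefl refl y<y

-- The count is only informative when x is the last letter of [x , y) in both
-- words; a letter of p strictly between x and y replaces y otherwise.
separated-right-< : ∀ r {x y p q v} → x ∉ p → x < y → y ∈ p →
                    (r ++ p) ++ x ∷ q ≡S r ++ x ∷ v → Any (Between x y) q
separated-right-< r {x} {y} {p} {q} {v} x∉p x<y y∈p e =
  decidable-stable (any? (between? x y) q) (go y (<-wellFounded y) x<y y∈p)
  where
  rest : p ++ q ↭ v
  rest = remove-↭ r (≡S⇒↭ e)

  go : ∀ y → Acc _<_ y → x < y → y ∈ p → ¬ ¬ Any (Between x y) q
  go y (acc rec) x<y y∈p ¬q with any? (between? x y) p
  ... | yes z∈p = let z , z∈p , x≤z , z<y = find z∈p in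
    go z (rec z<y) (≤∧≢⇒< x≤z λ x≡z → x∉p (subst (_∈ p) (sym x≡z) z∈p)) z∈p
      λ q′ → let w , w∈q , x≤w , w<z = find q′ in ¬q (lose w∈q (x≤w , <-trans w<z z<y))
  ... | no ¬p = <-irrefl refl (begin-strict
      count y q                              <⟨ m<n+m _ (count-∈ y∈p) ⟩
      count y p + count y q                  ≡⟨ count-++ y p q ⟨
      count y (p ++ q)                       ≡⟨ count-↭ y rest ⟩
      count y v                              ≡⟨ countAfter-hit r v ¬v (≤-refl , x<y) ⟨
      countAfter x y (r ++ x ∷ v)            ≡⟨ ≡S⇒countAfter x y e ⟨
      countAfter x y ((r ++ p) ++ x ∷ q)     ≡⟨ countAfter-hit (r ++ p) q ¬q (≤-refl , x<y) ⟩
      count y q                              ∎)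
    where
    open ≤-Reasoning
    ¬v : ¬ Any (Between x y) v
    ¬v = [ ¬p , ¬q ]′ ∘ Any.++⁻ p ∘ Any-resp-↭ (↭-sym rest)

-- Adjacent swaps in the three congruences

module _ {R : Rel Word 0ℓ} where

  private
    infix 4 _∼_
    _∼_ : Rel Word 0ℓ
    _∼_ = Congruence R

  ≡⇒∼ : ∀ {u v} → u ≡ v → u ∼ v
  ≡⇒∼ refl = crefl

  prefix-∼ : ∀ s {u v} → u ∼ v → s ++ u ∼ s ++ v
  prefix-∼ s = ccong (crefl {u = s})

  suffix-∼ : ∀ t {u v} → u ∼ v → u ++ t ∼ v ++ t
  suffix-∼ t p = ccong p (crefl {u = t})

≡S-swap : ∀ {a d q} → Any (Between a d) q → a ∷ d ∷ q ≡S d ∷ a ∷ q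
≡S-swap {a} {d} sep with find sep
... | b , b∈q , a≤b , b<d with ∈-∃++ b∈q
... | v , t , refl =
  subst₂ _≡S_ (cong (λ w → a ∷ d ∷ w) (++-assoc v [ b ] t)) (cong (λ w → d ∷ a ∷ w) (++-assoc v [ b ] t))
    (suffix-∼ t (gen (sylvester v a b d a≤b b<d)))

≡S#-swap : ∀ {a d s} t → Any (Between# a d) s → s ++ a ∷ d ∷ t ≡S# s ++ d ∷ a ∷ t
≡S#-swap {a} {d} t sep with find sep
... | b , b∈s , a<b , b≤d with ∈-∃++ b∈s
... | s , u , refl = subst₂ _≡S#_ (shape a d) (shape d a)
    (prefix-∼ s (suffix-∼ t (gen (sylvester# u a b d a<b b≤d))))
  where
  shape : ∀ x y → s ++ (b ∷ u ++ x ∷ y ∷ []) ++ t ≡ (s ++ b ∷ u) ++ x ∷ y ∷ t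
  shape x y = trans (cong (s ++_) (++-assoc (b ∷ u) (x ∷ y ∷ []) t)) (sym (++-assoc s (b ∷ u) (x ∷ y ∷ t)))

-- The order of the two witnesses selects the relation: `b < c` gives the first, and `c ≤ b` gives
-- `a < c ≤ b < d`, hence the second read backwards.
≡B-swap : ∀ {a d s q} → a < d → Any (Between# a d) s → Any (Between a d) q →
          s ++ a ∷ d ∷ q ≡B s ++ d ∷ a ∷ q
≡B-swap {a} {d} a<d sepˡ sepʳ with find sepˡ | find sepʳ
... | c , c∈s , a<c , c≤d | b , b∈q , a≤b , b<d with ∈-∃++ c∈s | ∈-∃++ b∈q
... | s , u , refl | v , t , refl =
  subst₂ _≡B_ (shape a d) (shape d a) (prefix-∼ s (suffix-∼ t move))
  where
  shape : ∀ x y → s ++ (c ∷ u ++ x ∷ y ∷ v ++ [ b ]) ++ t ≡ (s ++ c ∷ u) ++ x ∷ y ∷ v ++ b ∷ t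
  shape x y = begin
    s ++ (c ∷ u ++ x ∷ y ∷ v ++ [ b ]) ++ t
      ≡⟨ cong (s ++_) (++-assoc (c ∷ u) (x ∷ y ∷ v ++ [ b ]) t) ⟩
    s ++ c ∷ u ++ x ∷ y ∷ (v ++ [ b ]) ++ t
      ≡⟨ cong (λ w → s ++ c ∷ u ++ x ∷ y ∷ w) (++-assoc v [ b ] t) ⟩
    s ++ c ∷ u ++ x ∷ y ∷ v ++ b ∷ t
      ≡⟨ ++-assoc s (c ∷ u) _ ⟨
    (s ++ c ∷ u) ++ x ∷ y ∷ v ++ b ∷ t ∎
    where open ≡-Reasoning

  move : c ∷ u ++ a ∷ d ∷ v ++ [ b ] ≡B c ∷ u ++ d ∷ a ∷ v ++ [ b ]
  move with b <? c
  ... | yes b<c = gen (baxter₁ u v a b c d a≤b b<c c≤d)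
  ... | no  b≮c = csym (gen (baxter₂ u v a c b d a<c (≮⇒≥ b≮c) b<d))

-- In both Baxter relations the final letter lies in [a , d), so it licenses the swap of `a` and
-- `d`.
≡B⇒≡S : _≡B_ ⇒ _≡S_
≡B⇒≡S = Congruence-least BaxterRel _≡S_ (Congruence-isCongruence SylvesterRel) rel
  where
  rel : BaxterRel ⇒ _≡S_
  rel (baxter₁ u v a b c d a≤b b<c c≤d) =
    prefix-∼ (c ∷ u) (≡S-swap (Any.++⁺ʳ v (here (a≤b , <-≤-trans b<c c≤d))))
  rel (baxter₂ u v a b c d a<b b≤c c<d) =
    prefix-∼ (b ∷ u) (csym (≡S-swap (Any.++⁺ʳ v (here (≤-trans (<⇒≤ a<b) b≤c , c<d)))))

-- Here the initial letter serves, since it lies in (a , d].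
≡B⇒≡S# : _≡B_ ⇒ _≡S#_
≡B⇒≡S# = Congruence-least BaxterRel _≡S#_ (Congruence-isCongruence SylvesterRel#) rel
  where
  rel : BaxterRel ⇒ _≡S#_
  rel (baxter₁ u v a b c d a≤b b<c c≤d) =
    ≡S#-swap (v ++ [ b ]) (here (≤-<-trans a≤b b<c , c≤d))
  rel (baxter₂ u v a b c d a<b b≤c c<d) =
    csym (≡S#-swap (v ++ [ c ]) (here (a<b , ≤-trans b≤c (<⇒≤ c<d))))

-- Rearranging one word into the other by Baxter moves

infix 4 _≡S∧S#_
_≡S∧S#_ : Rel Word 0ℓ
u ≡S∧S# v = u ≡S v × u ≡S# v

-- This keeps both invariants available after each Baxter move, so that the next swap can be
-- justified in the same way.
≡S∧S#-respˡ : ∀ {u u′ v} → u ≡B u′ → u ≡S∧S# v → u′ ≡S∧S# v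
≡S∧S#-respˡ p (e , e#) = ctrans (csym (≡B⇒≡S p)) e , ctrans (csym (≡B⇒≡S# p)) e#

step : ∀ r {x y p q v} → x ∉ p → x ≢ y → (r ++ p) ++ y ∷ x ∷ q ≡S∧S# r ++ x ∷ v →
       (r ++ p) ++ y ∷ x ∷ q ≡B (r ++ p) ++ x ∷ y ∷ q
step r {x} {y} {p} {q} x∉p x≢y (e , e#) with <-cmp x y
... | tri≈ _ x≡y _ = contradiction x≡y x≢y
... | tri> _ _ y<x =
  ≡B-swap y<x (separated-left-> r y<x e#) (separated-right-> r x∉p y<x e)
... | tri< x<y _ _ =
  csym (≡B-swap x<y (separated-left-< r x∉p x<y e#)
    -- The letter `y` is absorbed into the block before `x`, which becomes `p ∷ʳ y` and still
    -- contains no `x`.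
    (separated-right-< r x∉p∷ʳy x<y (∈-++⁺ʳ p (here refl)) (subst (_≡S _) (++-∷-shift r p y (x ∷ q)) e)))
  where
  x∉p∷ʳy : x ∉ p ∷ʳ y
  x∉p∷ʳy x∈ with ∈-++⁻ p x∈
  ... | inj₁ x∈p        = x∉p x∈p
  ... | inj₂ (here x≡y) = x≢y x≡y

-- The reverse view exposes the last letter of `p`, the left neighbour of `x`. Once crossed, it
-- moves to the front of `q`.
bubble : ∀ r {x p} → Reverse p → ∀ q {v} → x ∉ p →
         r ++ p ++ x ∷ q ≡S∧S# r ++ x ∷ v → r ++ p ++ x ∷ q ≡B r ++ x ∷ p ++ q
bubble r []                 q x∉p e = crefl
bubble r {x} (p ∶ ps ∶ʳ y) q {v} x∉p e =
  ctrans first (ctrans (bubble r ps (y ∷ q) x∉p′ (≡S∧S#-respˡ first e)) last)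
  where
  x∉p′ : x ∉ p
  x∉p′ = x∉p ∘ ∈-++⁺ˡ

  x≢y : x ≢ y
  x≢y refl = x∉p (∈-++⁺ʳ p (here refl))

  shape : r ++ p ∷ʳ y ++ x ∷ q ≡ (r ++ p) ++ y ∷ x ∷ q
  shape = trans (cong (r ++_) (∷ʳ-++ p y (x ∷ q))) (sym (++-assoc r p _))

  first : r ++ p ∷ʳ y ++ x ∷ q ≡B r ++ p ++ x ∷ y ∷ q
  first = subst₂ _≡B_ (sym shape) (++-assoc r p _)
            (step r x∉p′ x≢y (subst (_≡S∧S# r ++ x ∷ v) shape e))

  last : r ++ x ∷ p ++ y ∷ q ≡B r ++ x ∷ p ∷ʳ y ++ q
  last = ≡⇒∼ (cong (λ w → r ++ x ∷ w) (sym (∷ʳ-++ p y q)))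

-- Taking the first occurrence leaves no `x` in `p`, as the counting arguments require.
first-∈ : ∀ {x u} → x ∈ u → ∃₂ λ p q → u ≡ p ++ x ∷ q × x ∉ p
first-∈ {x} {y ∷ u} x∈ with x ≟ y | x∈
... | yes refl | _        = [] , u , refl , λ ()
... | no x≢y   | here x≡y = contradiction x≡y x≢y
... | no x≢y   | there x∈u with first-∈ x∈u
... | p , q , refl , x∉p = y ∷ p , q , refl , λ { (here x≡y) → x≢y x≡y ; (there x∈p) → x∉p x∈p }

-- Induction on `v`, each step moving one letter into the common prefix. The prefix `r` is carried
-- along rather than cancelled because its letters may be the left separators of later swaps.
≡S∧S#⇒≡B-++ : ∀ r v {u} → r ++ u ≡S∧S# r ++ v → r ++ u ≡B r ++ v
≡S∧S#⇒≡B-++ r [] e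
  with refl ← ↭-empty-inv (++-cancelˡ-↭ r (≡S⇒↭ (proj₁ e))) = crefl
≡S∧S#⇒≡B-++ r (x ∷ v) e
  with p , q , refl , x∉p ← first-∈ (∈-resp-↭ (↭-sym (++-cancelˡ-↭ r (≡S⇒↭ (proj₁ e)))) (here refl)) =
  ctrans moved (subst₂ _≡B_ (∷ʳ-++ r x (p ++ q)) (∷ʳ-++ r x v)
    (≡S∧S#⇒≡B-++ (r ∷ʳ x) v
      (subst₂ _≡S∧S#_ (sym (∷ʳ-++ r x (p ++ q))) (sym (∷ʳ-++ r x v)) (≡S∧S#-respˡ moved e))))
  where
  moved : r ++ p ++ x ∷ q ≡B r ++ x ∷ p ++ q
  moved = bubble r (reverseView p) q x∉p e

proposition3p7 : (u v : Word) → (u ≡B v) ⇔ ((u ≡S v) × (u ≡S# v))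
proposition3p7 u v = mk⇔ (λ e → ≡B⇒≡S e , ≡B⇒≡S# e) (≡S∧S#⇒≡B-++ [] v)
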